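{- Let $R$ be a function from a recursive subset of $\mathbb{N}^2$ to $\mathbb{N}$ such that $R(n,w)\in B^n$ whenever defined. Then there exists a coloring function $c:\mathbb{N}\rightarrow\{0,1\}$, uniformly recursive in $R$, such that for any $w\in\mathbb{Z}^+$ and any $n<\lambda(w)$, if $R(n,w)$ is defined then $c(w)\neq c(R(n,w)+w)$.
   Context: For $x=\sum_{i=0}^{k}2^{n_i}\in\mathbb{Z}^+$ with $n_0<\dots<n_k$, set $\mu(x)=n_k$ and $\lambda(x)=n_0$. For $n\in\mathbb{N}$, $B^n=\{x\in\mathbb{Z}^+:\mu(x)=n\}$. -}

module Defs where

open import Data.Nat using (ℕ; zero; suc; _%_; _≡ᵇ_; ⌊_/2⌋; _<_; _≤_; _^_; _*_)
open import Data.Nat.Logarithm using (⌊log₂_⌋)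
open import Data.Bool using (Bool; true; false; if_then_else_; _∧_; not)
open import Data.Product using (_×_)
open import Relation.Binary.PropositionalEquality using (_≡_)

-- μ(x): exponent of the highest power of 2 in the binary expansion of x
-- (for x ∈ ℤ⁺ this is ⌊log₂ x⌋).
μ : ℕ → ℕ
μ x = ⌊log₂ x ⌋

-- λ(x): exponent of the lowest power of 2 in the binary expansion of x,
-- i.e. the number of trailing zero bits of x (meaningful for x > 0).
trailingZeros : ℕ → ℕ → ℕ
trailingZeros zero    _ = 0
trailingZeros (suc f) x =
  if (x % 2 ≡ᵇ 0) ∧ not (x ≡ᵇ 0) then suc (trailingZeros f ⌊ x /2⌋) else 0

lam : ℕ → ℕ
lam x = trailingZeros x x

InB : ℕ → ℕ → Set
InB n x = (0 < x) × (μ x ≡ n)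

-- Colour n by the parity of edge weights collected along the binary expansion of n,
-- read from the top bit down: the bit 2ᵐ of n, reached after the higher part v of n,
-- contributes a weight ω(v, m). Two numbers w and x + w with x ∈ Bⁿ and n < λ(w) share
-- every step of this walk above bit n, so their colours differ by the weights of the last
-- n + 1 steps of x + w. Those begin with ω(w, n), and ω(w, n) can be chosen to make that
-- sum odd: the remaining n steps only involve weights at levels below n, so the weights
-- are defined by recursion on the level, and each depends on R at a single point.
module Submission where

open import Defs
open import Data.Nat using (ℕ; _+_; _<_)
open import Data.Bool using (Bool)
open import Data.Maybe using (Maybe; just)
open import Data.Product using (Σ)
open import Relation.Binary.PropositionalEquality using (_≡_; _≢_)

open import Data.Nat
  using (zero; suc; _≤_; _≤′_; ≤′-refl; ≤′-step; _^_; _*_; _∸_; _≤ᵇ_; _%_; _≡ᵇ_; ⌊_/2⌋; z≤n; s≤s; s≤s⁻¹)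
open import Data.Nat.Properties
open import Data.Nat.Divisibility using (_∣_; divides; *-monoʳ-∣)
open import Data.Nat.Induction using (<-wellFounded)
open import Data.Nat.Logarithm using (⌊log₂_⌋; ⌊log₂⌋-mono-≤; ⌊log₂[2^n]⌋≡n)
open import Data.Nat.Logarithm.Core using (⌊log2⌋)
open import Data.Bool using (true; false; not; _xor_; if_then_else_; T)
open import Data.Bool.Properties using (xor-assoc; xor-comm; xor-inverseˡ; not-¬)
open import Data.Maybe using (maybe)
open import Data.Product using (_,_; ∃-syntax; _×_)
open import Data.Sum using (_⊎_; inj₁; inj₂)
open import Data.Unit using (tt)
open import Induction.WellFounded using (Acc; acc)
open import Relation.Nullary using (yes; no; contradiction)
open import Relation.Binary.PropositionalEquality using (refl; sym; trans; cong; cong₂; subst; module ≡-Reasoning)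

n<2^n : ∀ n → n < 2 ^ n
n<2^n zero    = s≤s z≤n
n<2^n (suc n) = begin-strict
  suc n          <⟨ s≤s (n<2^n n) ⟩
  suc (2 ^ n)    ≡⟨ +-comm 1 (2 ^ n) ⟩
  2 ^ n + 1      ≤⟨ +-monoʳ-≤ (2 ^ n) (m^n>0 2 n) ⟩
  2 ^ n + 2 ^ n  ≡⟨ cong (2 ^ n +_) (sym (+-identityʳ (2 ^ n))) ⟩
  2 ^ suc n      ∎
  where open ≤-Reasoning

m<2*n⇒m<n⊎m≡n+r : ∀ {m n} → m < 2 * n → m < n ⊎ ∃[ r ] r < n × m ≡ n + r
m<2*n⇒m<n⊎m≡n+r {m} {n} m<2n with m <? n
... | yes m<n = inj₁ m<n
... | no m≮n  = inj₂ (m ∸ n , r<n , sym (m+[n∸m]≡n n≤m))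
  where
  n≤m = ≮⇒≥ m≮n
  r<n : m ∸ n < n
  r<n = +-cancelˡ-< n (m ∸ n) n (begin-strict
    n + (m ∸ n)  ≡⟨ m+[n∸m]≡n n≤m ⟩
    m            <⟨ m<2n ⟩
    2 * n        ≡⟨ cong (n +_) (+-identityʳ n) ⟩
    n + n        ∎)
    where open ≤-Reasoning

q*2^j+x<2^[d+j] : ∀ d j {q x} → q < 2 ^ d → x < 2 ^ j → q * 2 ^ j + x < 2 ^ (d + j)
q*2^j+x<2^[d+j] d j {q} {x} q<2^d x<2^j = begin-strict
  q * 2 ^ j + x      <⟨ +-monoʳ-< (q * 2 ^ j) x<2^j ⟩
  q * 2 ^ j + 2 ^ j  ≡⟨ +-comm (q * 2 ^ j) (2 ^ j) ⟩
  suc q * 2 ^ j      ≤⟨ *-monoˡ-≤ (2 ^ j) q<2^d ⟩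
  2 ^ d * 2 ^ j      ≡⟨ ^-distribˡ-+-* 2 d j ⟨
  2 ^ (d + j)        ∎
  where open ≤-Reasoning

[2^d+r]*2^j≡2^[d+j]+r*2^j : ∀ d j r → (2 ^ d + r) * 2 ^ j ≡ 2 ^ (d + j) + r * 2 ^ j
[2^d+r]*2^j≡2^[d+j]+r*2^j d j r =
  trans (*-distribʳ-+ (2 ^ j) (2 ^ d) r) (cong (_+ r * 2 ^ j) (sym (^-distribˡ-+-* 2 d j)))

n%2≡0⇒n≡2*⌊n/2⌋ : ∀ n → n % 2 ≡ 0 → n ≡ 2 * ⌊ n /2⌋
n%2≡0⇒n≡2*⌊n/2⌋ zero          _  = refl
n%2≡0⇒n≡2*⌊n/2⌋ (suc (suc n)) eq = cong suc (trans (cong suc (n%2≡0⇒n≡2*⌊n/2⌋ n eq)) (sym (+-suc ⌊ n /2⌋ (⌊ n /2⌋ + 0))))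

2*⌊n/2⌋≤n : ∀ n → 2 * ⌊ n /2⌋ ≤ n
2*⌊n/2⌋≤n zero          = z≤n
2*⌊n/2⌋≤n (suc zero)    = z≤n
2*⌊n/2⌋≤n (suc (suc n)) = subst (_≤ 2 + n) (sym (cong suc (+-suc ⌊ n /2⌋ (⌊ n /2⌋ + 0))))
                                (s≤s (s≤s (2*⌊n/2⌋≤n n)))

2^trailingZeros∣n : ∀ f n k → k ≤ trailingZeros f n → 2 ^ k ∣ n
2^trailingZeros∣n f       n zero    _ = divides n (sym (*-identityʳ n))
2^trailingZeros∣n zero    n (suc k) ()
2^trailingZeros∣n (suc f) n (suc k) k<tz with n % 2 ≡ᵇ 0 in even | n ≡ᵇ 0
... | false | _     = contradiction k<tz λ ()
... | true  | true  = contradiction k<tz λ ()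
... | true  | false =
  subst (2 ^ suc k ∣_) (sym (n%2≡0⇒n≡2*⌊n/2⌋ n (≡ᵇ⇒≡ (n % 2) 0 (subst T (sym even) tt))))
        (*-monoʳ-∣ 2 (2^trailingZeros∣n f ⌊ n /2⌋ k (s≤s⁻¹ k<tz)))

k≤lam⇒2^k∣n : ∀ {k n} → k ≤ lam n → 2 ^ k ∣ n
k≤lam⇒2^k∣n {k} {n} = 2^trailingZeros∣n n n k

2^⌊log2⌋n≤n : ∀ n (rec : Acc _<_ n) → 0 < n → 2 ^ ⌊log2⌋ n rec ≤ n
2^⌊log2⌋n≤n 1             _        _ = ≤-refl
2^⌊log2⌋n≤n (suc (suc n)) (acc rs) _ = begin
  2 * 2 ^ ⌊log2⌋ (suc ⌊ n /2⌋) _  ≤⟨ *-monoʳ-≤ 2 (2^⌊log2⌋n≤n (suc ⌊ n /2⌋) _ (s≤s z≤n)) ⟩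
  2 * ⌊ suc (suc n) /2⌋           ≤⟨ 2*⌊n/2⌋≤n (suc (suc n)) ⟩
  suc (suc n)                     ∎
  where open ≤-Reasoning

2^⌊log₂n⌋≤n : ∀ {n} → 0 < n → 2 ^ ⌊log₂ n ⌋ ≤ n
2^⌊log₂n⌋≤n {n} = 2^⌊log2⌋n≤n n (<-wellFounded n)

n<2^suc⌊log₂n⌋ : ∀ n → n < 2 ^ suc ⌊log₂ n ⌋
n<2^suc⌊log₂n⌋ n with 2 ^ suc ⌊log₂ n ⌋ ≤? n
... | no  n≮2^k = ≰⇒> n≮2^k
... | yes 2^k≤n = contradiction
  (subst (_≤ ⌊log₂ n ⌋) (⌊log₂[2^n]⌋≡n (suc ⌊log₂ n ⌋)) (⌊log₂⌋-mono-≤ 2^k≤n)) (<-irrefl refl)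

InB⇒2^n≤x : ∀ {n x} → InB n x → 2 ^ n ≤ x
InB⇒2^n≤x (0<x , refl) = 2^⌊log₂n⌋≤n 0<x

InB⇒x<2^suc-n : ∀ {n x} → InB n x → x < 2 ^ suc n
InB⇒x<2^suc-n {x = x} (_ , refl) = n<2^suc⌊log₂n⌋ x

module Colouring (R : ℕ → ℕ → Maybe ℕ) where

  mutual
    -- For x < 2ᵐ, the parity of the weights met on the path v, v + 2^m₁, v + 2^m₁ + 2^m₂, …
    -- where m₁ > m₂ > … are the set bits of x; the weight of the step adding 2^mᵢ is read
    -- at its start.
    pathParity : ℕ → ℕ → ℕ → Bool
    pathParity zero    v x = false
    pathParity (suc m) v x = if 2 ^ m ≤ᵇ x
      then weight v m xor pathParity m (v + 2 ^ m) (x ∸ 2 ^ m)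
      else pathParity m v x

    -- Chosen so that the path from v to v + y has odd parity whenever R m v ≡ just y.
    weight : ℕ → ℕ → Bool
    weight v m = maybe (λ y → not (pathParity m (v + 2 ^ m) (y ∸ 2 ^ m))) false (R m v)

  weight-just : ∀ {m v y} → R m v ≡ just y → weight v m ≡ not (pathParity m (v + 2 ^ m) (y ∸ 2 ^ m))
  weight-just Rmv≡y rewrite Rmv≡y = refl

  -- n levels suffice since n < 2ⁿ.
  colour : ℕ → Bool
  colour n = pathParity n 0 n

  pathParity-≥ : ∀ m v {x} → 2 ^ m ≤ x →
    pathParity (suc m) v x ≡ weight v m xor pathParity m (v + 2 ^ m) (x ∸ 2 ^ m)
  pathParity-≥ m v {x} 2^m≤x with 2 ^ m ≤ᵇ x | ≤⇒≤ᵇ 2^m≤x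
  ... | true | _ = refl

  pathParity-< : ∀ m v {x} → x < 2 ^ m → pathParity (suc m) v x ≡ pathParity m v x
  pathParity-< m v {x} x<2^m with 2 ^ m ≤ᵇ x in le
  ... | true  = contradiction (≤ᵇ⇒≤ (2 ^ m) x (subst T (sym le) tt)) (<⇒≱ x<2^m)
  ... | false = refl

  pathParity-+ : ∀ m v y → pathParity (suc m) v (2 ^ m + y) ≡ weight v m xor pathParity m (v + 2 ^ m) y
  pathParity-+ m v y = trans (pathParity-≥ m v (m≤m+n (2 ^ m) y))
    (cong (λ z → weight v m xor pathParity m (v + 2 ^ m) z) (m+n∸m≡n (2 ^ m) y))

  pathParity-zero : ∀ m v → pathParity m v 0 ≡ false
  pathParity-zero zero    v = refl
  pathParity-zero (suc m) v = trans (pathParity-< m v (m^n>0 2 m)) (pathParity-zero m v)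

  pathParity-fuel : ∀ {m K} v {x} → m ≤ K → x < 2 ^ m → pathParity K v x ≡ pathParity m v x
  pathParity-fuel v {x} m≤K x<2^m = go (≤⇒≤′ m≤K)
    where
    go : ∀ {K} → _ ≤′ K → pathParity K v x ≡ _
    go ≤′-refl                = refl
    go (≤′-step {n = K} m≤′K) =
      trans (pathParity-< K v (<-≤-trans x<2^m (^-monoʳ-≤ 2 (≤′⇒≤ m≤′K)))) (go m≤′K)

  pathParity-split : ∀ d {j} q {x} v → q < 2 ^ d → x < 2 ^ j →
    pathParity (d + j) v (q * 2 ^ j + x) ≡ pathParity (d + j) v (q * 2 ^ j) xor pathParity j (v + q * 2 ^ j) x
  pathParity-split zero    {j} zero    {x} v _ _ =
    sym (cong₂ _xor_ (pathParity-zero j v) (cong (λ u → pathParity j u x) (+-identityʳ v)))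
  pathParity-split zero        (suc q) v (s≤s ()) _
  pathParity-split (suc d) {j} q     {x} v q<2^[1+d] x<2^j with m<2*n⇒m<n⊎m≡n+r q<2^[1+d]
  ... | inj₁ q<2^d = begin
    pathParity (suc (d + j)) v (q * 2 ^ j + x)
      ≡⟨ pathParity-< (d + j) v (q*2^j+x<2^[d+j] d j q<2^d x<2^j) ⟩
    pathParity (d + j) v (q * 2 ^ j + x)
      ≡⟨ pathParity-split d q v q<2^d x<2^j ⟩
    pathParity (d + j) v (q * 2 ^ j) xor pathParity j (v + q * 2 ^ j) x
      ≡⟨ cong (_xor pathParity j (v + q * 2 ^ j) x) (pathParity-< (d + j) v q*2^j<2^[d+j]) ⟨
    pathParity (suc (d + j)) v (q * 2 ^ j) xor pathParity j (v + q * 2 ^ j) x ∎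
    where
    open ≡-Reasoning
    q*2^j<2^[d+j] = ≤-<-trans (m≤m+n (q * 2 ^ j) x) (q*2^j+x<2^[d+j] d j q<2^d x<2^j)
  ... | inj₂ (r , r<2^d , refl) = begin
    pathParity (suc (d + j)) v ((2 ^ d + r) * 2 ^ j + x)
      ≡⟨ cong (pathParity (suc (d + j)) v) q*2^j+x≡t+[r*2^j+x] ⟩
    pathParity (suc (d + j)) v (t + (r * 2 ^ j + x))
      ≡⟨ pathParity-+ (d + j) v (r * 2 ^ j + x) ⟩
    ω xor pathParity (d + j) (v + t) (r * 2 ^ j + x)
      ≡⟨ cong (ω xor_) (pathParity-split d r (v + t) r<2^d x<2^j) ⟩
    ω xor (pathParity (d + j) (v + t) (r * 2 ^ j) xor pathParity j (v + t + r * 2 ^ j) x)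
      ≡⟨ xor-assoc ω _ _ ⟨
    (ω xor pathParity (d + j) (v + t) (r * 2 ^ j)) xor pathParity j (v + t + r * 2 ^ j) x
      ≡⟨ cong₂ _xor_ (pathParity-+ (d + j) v (r * 2 ^ j)) (cong (λ u → pathParity j u x) (sym (+-assoc v t _))) ⟨
    pathParity (suc (d + j)) v (t + r * 2 ^ j) xor pathParity j (v + (t + r * 2 ^ j)) x
      ≡⟨ cong (λ z → pathParity (suc (d + j)) v z xor pathParity j (v + z) x) q*2^j≡t+r*2^j ⟨
    pathParity (suc (d + j)) v ((2 ^ d + r) * 2 ^ j) xor pathParity j (v + (2 ^ d + r) * 2 ^ j) x ∎
    where
    open ≡-Reasoning
    t = 2 ^ (d + j)
    ω = weight v (d + j)
    q*2^j≡t+r*2^j = [2^d+r]*2^j≡2^[d+j]+r*2^j d j r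
    q*2^j+x≡t+[r*2^j+x] = trans (cong (_+ x) q*2^j≡t+r*2^j) (+-assoc t (r * 2 ^ j) x)

  colour-split : ∀ {j} q {x} → x < 2 ^ j → colour (q * 2 ^ j + x) ≡ colour (q * 2 ^ j) xor pathParity j (q * 2 ^ j) x
  colour-split {j} q {x} x<2^j = begin
    pathParity n 0 n                                         ≡⟨ pathParity-fuel 0 (m≤m+n n j) (n<2^n n) ⟨
    pathParity (n + j) 0 n                                   ≡⟨ pathParity-split n q 0 q<2^n x<2^j ⟩
    pathParity (n + j) 0 a xor pathParity j a x              ≡⟨ cong (_xor pathParity j a x) (pathParity-fuel 0 a≤n+j (n<2^n a)) ⟩
    pathParity a 0 a xor pathParity j a x                    ∎
    where
    open ≡-Reasoning
    a = q * 2 ^ j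
    n = a + x
    a≤n+j = ≤-trans (m≤m+n a x) (m≤m+n n j)
    q<2^n = ≤-<-trans (≤-trans (m≤m*n q (2 ^ j) {{m^n≢0 2 j}}) (m≤m+n a x)) (n<2^n n)

  pathParity-edge : ∀ {n w x} → 2 ^ n ≤ x → R n w ≡ just x → pathParity (suc n) w x ≡ true
  pathParity-edge {n} {w} {x} 2^n≤x Rnw≡x = begin
    pathParity (suc n) w x                 ≡⟨ pathParity-≥ n w 2^n≤x ⟩
    weight w n xor b                       ≡⟨ cong (_xor b) (weight-just Rnw≡x) ⟩
    not b xor b                            ≡⟨ xor-inverseˡ b ⟩
    true                                   ∎
    where
    open ≡-Reasoning
    b = pathParity n (w + 2 ^ n) (x ∸ 2 ^ n)

  colour-flips : ∀ {n w x} → 2 ^ suc n ∣ w → InB n x → R n w ≡ just x → colour (x + w) ≡ not (colour w)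
  colour-flips {n} {x = x} (divides q refl) x∈Bⁿ Rnw≡x = begin
    colour (x + w)                          ≡⟨ cong colour (+-comm x w) ⟩
    colour (w + x)                          ≡⟨ colour-split {suc n} q (InB⇒x<2^suc-n x∈Bⁿ) ⟩
    colour w xor pathParity (suc n) w x     ≡⟨ cong (colour w xor_) (pathParity-edge (InB⇒2^n≤x {n} x∈Bⁿ) Rnw≡x) ⟩
    colour w xor true                       ≡⟨ xor-comm (colour w) true ⟩
    not (colour w)                          ∎
    where
    open ≡-Reasoning
    w = q * 2 ^ suc n

mainTheorem6 : (R : ℕ → ℕ → Maybe ℕ)
    → (∀ n w x → R n w ≡ just x → InB n x)
    → Σ (ℕ → Bool) (λ c → ∀ w → 0 < w → ∀ n → n < lam w → ∀ x → R n w ≡ just x → c w ≢ c (x + w))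
mainTheorem6 R R∈B = colour , λ w _ n n<λw x Rnw≡x c≡ →
  not-¬ refl (trans c≡ (colour-flips (k≤lam⇒2^k∣n n<λw) (R∈B n w x Rnw≡x) Rnw≡x))
  where open Colouring R
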